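{- The system $\mathsf{MLSdli}$ polynomially simulates any proof system for multiplicative linear logic: for every proof system $\mathcal S'$ for multiplicative linear logic there is a polynomial $p$ such that for every proof $\Pi$ in $\mathcal S'$ there is a proof $\Pi'$ in $\mathsf{MLSdli}$ of the same formula with $|\Pi'|\le p(|\Pi|)$.
   Context: Structures. There are countably many atoms $a,b,c,\dots$; structures (formulae) of multiplicative linear logic are generated by $R ::= a \mid \mathsf 1 \mid \bot \mid [R \wp R] \mid (R\otimes R) \mid \overline{R}$, where $\mathsf 1$ and $\bot$ (the units) are regarded as special atoms. $[R\wp T]$ is called a par structure, $(R\otimes T)$ a copar structure. Structures are considered modulo $\approx$, the smallest congruence induced by associativity and commutativity of $\wp$ and of $\otimes$ and by $\overline{[R\wp T]}\approx(\overline R\otimes\overline T)$, $\overline{(R\otimes T)}\approx[\overline R\wp\overline T]$, $\overline{\overline R}\approx R$, $\overline\bot\approx\mathsf 1$, $\overline{\mathsf 1}\approx\bot$; they are taken in negation normal form. A context $S\{\ \}$ is a structure with one hole not in the scope of a negation; $S\{R\}$ is the result of filling it with $R$; $S[R\wp T]$, $S(R\otimes T)$ abbreviate $S\{[R\wp T]\}$, $S\{(R\otimes T)\}$. $\mathsf{at}\,R$ is the set of atoms (including units; $a$ and $\overline a$ are different elements) occurring in $R$ in negation normal form. System $\mathsf{MLSdli}$ consists of the rules (for all contexts $S\{\ \}$, structures $R,T,U$, atoms $a$): - $\mathsf{ai}{\downarrow}$: premise $S\{\mathsf 1\}$, conclusion $S[a\wp\overline a]$. - $\mathsf u_1{\downarrow}$: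 premise $S\{R\}$, conclusion $S[R\wp\bot]$. - $\mathsf u_2{\downarrow}$: premise $S\{R\}$, conclusion $S(R\otimes\mathsf 1)$. - $\mathsf{dlis}$ (deep lazy interaction switch): premise $S([U\wp R]\otimes T)$, conclusion $S[U\wp(R\otimes T)]$, provided that $\mathsf{at}\,\overline R\cap\mathsf{at}\,U\neq\emptyset$, that $U$ is a copar structure or an atom different from $\bot$, and that $R$ is a par structure or an atom different from $\mathsf 1$. A proof of $R$ in $\mathsf{MLSdli}$ is a finite chain of rule instances (possibly none) with top-most structure $\mathsf 1$ and bottom-most structure $R$. The size $|\Pi|$ of a proof $\Pi$ is the number of unit and atom occurrences appearing in it. A proof system for multiplicative linear logic is a system whose provable formulae are exactly the theorems of multiplicative linear logic, i.e. the formulae $R$ such that $\vdash R$ is derivable in the sequent calculus with rules: axiom $\vdash A,\overline A$; axiom $\vdash\mathsf 1$; from $\vdash\Phi$ infer $\vdash\bot,\Phi$; from $\vdash A,B,\Phi$ infer $\vdash[A\wp B],\Phi$; from $\vdash A,\Phi$ and $\vdash B,\Psi$ infer $\vdash(A\otimes B),\Phi,\Psi$. It is understood that the proved formula appears in its proof, so that $|\Pi|$ is at least the number of atom and unit occurrences of the formula proved by $\Pi$. -}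

module Defs where

open import Data.Nat using (ℕ; _+_; _*_; _≤_)
open import Data.List using (List; []; _∷_; [_]; _++_; length; foldr)
open import Data.List.Membership.Propositional using (_∈_)
open import Data.List.Relation.Binary.Permutation.Propositional using (_↭_)
open import Data.Product using (∃)
open import Function.Bundles using (_⇔_)
open import Level using (Level; 0ℓ) renaming (suc to lsuc)
open import Relation.Binary.PropositionalEquality using (_≢_)
open import Relation.Unary using (Pred; _≬_)

infixr 7 _⊗_ _⊗ˡ_ _⊗ʳ_
infixr 6 _⅋_ _⅋ˡ_ _⅋ʳ_
infix  4 _≈_ _⟶_ ⊢_

data Structure : Set where
  atom    : ℕ → Structure
  𝟙 ⊥     : Structure
  _⅋_ _⊗_ : Structure → Structure → Structure
  ‾       : Structure → Structure

data _≈_ : Structure → Structure → Set where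
  ≈-refl  : ∀ {R} → R ≈ R
  ≈-sym   : ∀ {R T} → R ≈ T → T ≈ R
  ≈-trans : ∀ {R T U} → R ≈ T → T ≈ U → R ≈ U
  ⅋-cong  : ∀ {R R′ T T′} → R ≈ R′ → T ≈ T′ → R ⅋ T ≈ R′ ⅋ T′
  ⊗-cong  : ∀ {R R′ T T′} → R ≈ R′ → T ≈ T′ → R ⊗ T ≈ R′ ⊗ T′
  ‾-cong  : ∀ {R R′} → R ≈ R′ → ‾ R ≈ ‾ R′
  ⅋-assoc : ∀ {R T U} → (R ⅋ T) ⅋ U ≈ R ⅋ (T ⅋ U)
  ⊗-assoc : ∀ {R T U} → (R ⊗ T) ⊗ U ≈ R ⊗ (T ⊗ U)
  ⅋-comm  : ∀ {R T} → R ⅋ T ≈ T ⅋ R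
  ⊗-comm  : ∀ {R T} → R ⊗ T ≈ T ⊗ R
  ‾-⅋     : ∀ {R T} → ‾ (R ⅋ T) ≈ ‾ R ⊗ ‾ T
  ‾-⊗     : ∀ {R T} → ‾ (R ⊗ T) ≈ ‾ R ⅋ ‾ T
  ‾-‾     : ∀ {R} → ‾ (‾ R) ≈ R
  ‾-⊥     : ‾ ⊥ ≈ 𝟙
  ‾-𝟙     : ‾ 𝟙 ≈ ⊥

-- The atoms of structures in negation normal form: a, its negation (a different
-- element), and the two units, which count as special atoms.
data Atom : Set where
  pos neg : ℕ → Atom
  𝟙 ⊥     : Atom

dualAtom : Atom → Atom
dualAtom (pos n) = neg n
dualAtom (neg n) = pos n
dualAtom 𝟙       = ⊥
dualAtom ⊥       = 𝟙

⌜_⌝ : Atom → Structure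
⌜ pos n ⌝ = atom n
⌜ neg n ⌝ = ‾ (atom n)
⌜ 𝟙 ⌝     = 𝟙
⌜ ⊥ ⌝     = ⊥

data NNF : Set where
  at′     : Atom → NNF
  _⅋_ _⊗_ : NNF → NNF → NNF

dual : NNF → NNF
dual (at′ a) = at′ (dualAtom a)
dual (A ⅋ B) = dual A ⊗ dual B
dual (A ⊗ B) = dual A ⅋ dual B

nnf : Structure → NNF
nnf (atom n) = at′ (pos n)
nnf 𝟙        = at′ 𝟙
nnf ⊥        = at′ ⊥
nnf (R ⅋ T)  = nnf R ⅋ nnf T
nnf (R ⊗ T)  = nnf R ⊗ nnf T
nnf (‾ R)    = dual (nnf R)

leaves : NNF → List Atom
leaves (at′ a) = [ a ]
leaves (A ⅋ B) = leaves A ++ leaves B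
leaves (A ⊗ B) = leaves A ++ leaves B

at : Structure → Pred Atom 0ℓ
at R a = a ∈ leaves (nnf R)

∣_∣ : Structure → ℕ
∣ R ∣ = length (leaves (nnf R))

data Context : Set where
  ∙         : Context
  _⅋ˡ_ _⊗ˡ_ : Context → Structure → Context
  _⅋ʳ_ _⊗ʳ_ : Structure → Context → Context

_⟨_⟩ : Context → Structure → Structure
∙        ⟨ R ⟩ = R
(S ⅋ˡ T) ⟨ R ⟩ = S ⟨ R ⟩ ⅋ T
(S ⊗ˡ T) ⟨ R ⟩ = S ⟨ R ⟩ ⊗ T
(T ⅋ʳ S) ⟨ R ⟩ = T ⅋ S ⟨ R ⟩
(T ⊗ʳ S) ⟨ R ⟩ = T ⊗ S ⟨ R ⟩

-- The next two conditions concern classes modulo ≈, so they are stated on the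
-- negation normal form: ‾ (R ⅋ T), for instance, is a copar structure.
data CoparOrAtom≢⊥ : NNF → Set where
  copar : ∀ {A B} → CoparOrAtom≢⊥ (A ⊗ B)
  atom  : ∀ {a} → a ≢ ⊥ → CoparOrAtom≢⊥ (at′ a)

data ParOrAtom≢𝟙 : NNF → Set where
  par  : ∀ {A B} → ParOrAtom≢𝟙 (A ⅋ B)
  atom : ∀ {a} → a ≢ 𝟙 → ParOrAtom≢𝟙 (at′ a)

-- P ⟶ Q: an instance of a rule of MLSdli with premise P and conclusion Q.
data _⟶_ : Structure → Structure → Set where
  ai↓  : ∀ S a → S ⟨ 𝟙 ⟩ ⟶ S ⟨ ⌜ a ⌝ ⅋ ‾ ⌜ a ⌝ ⟩
  u₁↓  : ∀ S R → S ⟨ R ⟩ ⟶ S ⟨ R ⅋ ⊥ ⟩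
  u₂↓  : ∀ S R → S ⟨ R ⟩ ⟶ S ⟨ R ⊗ 𝟙 ⟩
  dlis : ∀ S R T U →
         at (‾ R) ≬ at U →
         CoparOrAtom≢⊥ (nnf U) →
         ParOrAtom≢𝟙 (nnf R) →
         S ⟨ (U ⅋ R) ⊗ T ⟩ ⟶ S ⟨ U ⅋ (R ⊗ T) ⟩

-- Proofs in MLSdli: each structure in the chain stands for its class modulo ≈,
-- so a step may use any representatives of two consecutive classes.
data MLSdli : Structure → Set where
  top  : ∀ {R} → R ≈ 𝟙 → MLSdli R
  step : ∀ {P Q R} → MLSdli P → P ⟶ Q → Q ≈ R → MLSdli R

-- Each class in the chain is counted once; ∣_∣ does not depend on the
-- representative.
proofSize : ∀ {R} → MLSdli R → ℕ
proofSize {R} (top _)      = ∣ R ∣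
proofSize {R} (step Π _ _) = proofSize Π + ∣ R ∣

data ⊢_ : List NNF → Set where
  ax   : ∀ A → ⊢ A ∷ dual A ∷ []
  one  : ⊢ [ at′ 𝟙 ]
  bot  : ∀ {Φ} → ⊢ Φ → ⊢ at′ ⊥ ∷ Φ
  par  : ∀ {A B Φ} → ⊢ A ∷ B ∷ Φ → ⊢ (A ⅋ B) ∷ Φ
  tens : ∀ {A B Φ Ψ} → ⊢ A ∷ Φ → ⊢ B ∷ Ψ → ⊢ (A ⊗ B) ∷ Φ ++ Ψ
  exch : ∀ {Φ Ψ} → Φ ↭ Ψ → ⊢ Φ → ⊢ Ψ

Theorem : Structure → Set
Theorem R = ⊢ [ nnf R ]

-- An arbitrary proof system for multiplicative linear logic.  The internal form
-- of its proofs is left open; their size is only required to account for the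
-- proved formula, which is understood to appear in the proof.
record ProofSystem (ℓ : Level) : Set (lsuc ℓ) where
  field
    Proof            : Set ℓ
    conclusion       : Proof → Structure
    size             : Proof → ℕ
    conclusion≤size  : ∀ Π → ∣ conclusion Π ∣ ≤ size Π
    provable⇔theorem : ∀ R → (∃ λ Π → conclusion Π ≈ R) ⇔ Theorem R

-- Polynomials over ℕ as coefficient lists, constant coefficient first.
Polynomial : Set
Polynomial = List ℕ

eval : Polynomial → ℕ → ℕ
eval p n = foldr (λ c v → c + n * v) 0 p

{-# OPTIONS --safe #-}

-- Every rule of MLSdli strictly increases, from premise to conclusion, the number
-- of leaves plus the number of pairs of leaves that meet in a par.  Hence a proof
-- of R has at most |R|² lines, of size at most |R| each, and any proof in MLSdli
-- has at most cubic size: only completeness is needed.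
--
-- For completeness, one rule instance with a provable premise is read off a cut-free
-- sequent proof.  An axiom on a, ā gives an instance of ai↓.  Consider a tensor rule
-- on A ⊗ B and the instance found for A, Γ.  If it joins a member of A with some y in
-- Γ, then y interacts with A and can be switched into the factor A of A ⊗ B, unless A
-- is itself a copar or 𝟙; in that case the switch found for A, Γ is still available for
-- A ⊗ B, by associativity of ⊗ or because A ⊗ B is switched in place of A.  If A is ⊥,
-- the context Γ is first reduced to 𝟙, which then interacts with A.

module Submission where

open import Defs
open import Level using (Level)
open import Data.Nat using (ℕ; suc; _+_; _*_; _≤_; _<_; z≤n; s≤s)
open import Data.Nat.Properties
  using (≤-reflexive; ≤-trans; <-≤-trans; ≤-<-trans; <⇒≤; m≤m+n; m<m+n; +-assoc; +-comm;
    +-mono-≤; +-monoˡ-≤; +-monoʳ-≤; +-monoˡ-<; +-monoʳ-<; +-mono-<-≤; *-comm; *-identityˡ;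
    *-distribˡ-+; *-mono-≤; *-monoˡ-≤; *-monoʳ-≤; module ≤-Reasoning)
open import Data.Nat.Induction using (Acc; acc; <-wellFounded)
open import Data.Nat.Tactic.RingSolver using (solve-∀)
open import Data.List using (List; []; _∷_; [_]; length; _++_; concatMap; map)
open import Data.List.Properties using (length-++; ++-identityʳ; ++-assoc; concatMap-++; map-++)
open import Data.List.Membership.Propositional using (_∈_)
open import Data.List.Membership.Propositional.Properties
  using (∈-++⁺ˡ; ∈-++⁺ʳ; ∈-++⁻; ∈-∃++; ∈-map⁺; ∈-map⁻)
open import Data.List.Relation.Unary.Any using (here; there)
open import Data.List.Relation.Binary.Permutation.Propositional
  using (_↭_; refl; prep; swap; trans; ↭-sym)
open import Data.List.Relation.Binary.Permutation.Propositional.Properties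
  using (↭-empty-inv; ↭-singleton-inv; ∈-resp-↭; ++⁺ˡ; ++⁺ʳ; shift; shifts; drop-∷; ++-comm;
    ++-commutativeMonoid)
open import Data.Product using (∃; _×_; _,_; ∃-syntax)
open import Data.Sum using (_⊎_; inj₁; inj₂)
open import Function.Bundles using (Equivalence)
open import Relation.Binary.PropositionalEquality as ≡ using (_≡_; refl; sym; cong; cong₂; subst)
open import Relation.Unary using (_≬_; _⊆_)
import Algebra.Solver.CommutativeMonoid as CommutativeMonoidSolver

-- Size and weight, and their invariance under `≈`.

size : NNF → ℕ
size (at′ _) = 1
size (A ⅋ B) = size A + size B
size (A ⊗ B) = size A + size B

-- size A plus the number of pairs of leaves whose least common ancestor is a par.
weight : NNF → ℕ
weight (at′ _) = 1
weight (A ⅋ B) = weight A + weight B + size A * size B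
weight (A ⊗ B) = weight A + weight B

length-leaves : ∀ A → length (leaves A) ≡ size A
length-leaves (at′ _) = refl
length-leaves (A ⅋ B) = ≡.trans (length-++ (leaves A)) (cong₂ _+_ (length-leaves A) (length-leaves B))
length-leaves (A ⊗ B) = ≡.trans (length-++ (leaves A)) (cong₂ _+_ (length-leaves A) (length-leaves B))

size-dual : ∀ A → size (dual A) ≡ size A
size-dual (at′ _) = refl
size-dual (A ⅋ B) = cong₂ _+_ (size-dual A) (size-dual B)
size-dual (A ⊗ B) = cong₂ _+_ (size-dual A) (size-dual B)

dualAtom-involutive : ∀ a → dualAtom (dualAtom a) ≡ a
dualAtom-involutive (pos _) = refl
dualAtom-involutive (neg _) = refl
dualAtom-involutive 𝟙       = refl
dualAtom-involutive ⊥       = refl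

dual-involutive : ∀ A → dual (dual A) ≡ A
dual-involutive (at′ a) = cong at′ (dualAtom-involutive a)
dual-involutive (A ⅋ B) = cong₂ _⅋_ (dual-involutive A) (dual-involutive B)
dual-involutive (A ⊗ B) = cong₂ _⊗_ (dual-involutive A) (dual-involutive B)

0<size : ∀ A → 0 < size A
0<size (at′ _) = s≤s z≤n
0<size (A ⅋ B) = ≤-trans (0<size A) (m≤m+n _ _)
0<size (A ⊗ B) = ≤-trans (0<size A) (m≤m+n _ _)

-- The weight of the dual is tracked because ‾ exchanges par and copar.
record _≅_ (A B : NNF) : Set where
  constructor mk≅
  field
    size≡    : size A ≡ size B
    weight≡  : weight A ≡ weight B
    dual≡    : weight (dual A) ≡ weight (dual B)

⅋-weight : ∀ {A A′ B B′} → size A ≡ size A′ → size B ≡ size B′ →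
           weight A ≡ weight A′ → weight B ≡ weight B′ → weight (A ⅋ B) ≡ weight (A′ ⅋ B′)
⅋-weight s t u v = cong₂ _+_ (cong₂ _+_ u v) (cong₂ _*_ s t)

dual-size : ∀ {A A′} → size A ≡ size A′ → size (dual A) ≡ size (dual A′)
dual-size {A} {A′} s = ≡.trans (size-dual A) (≡.trans s (sym (size-dual A′)))

⅋-weight-assoc : ∀ A B C → weight ((A ⅋ B) ⅋ C) ≡ weight (A ⅋ (B ⅋ C))
⅋-weight-assoc A B C = assoc (weight A) (weight B) (weight C) (size A) (size B) (size C)
  where
  assoc : ∀ a b c x y z → (a + b + x * y) + c + (x + y) * z ≡ a + (b + c + y * z) + x * (y + z)
  assoc = solve-∀

⅋-weight-comm : ∀ A B → weight (A ⅋ B) ≡ weight (B ⅋ A)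
⅋-weight-comm A B = cong₂ _+_ (+-comm (weight A) _) (*-comm (size A) _)

≈⇒≅ : ∀ {R T} → R ≈ T → nnf R ≅ nnf T
≈⇒≅ ≈-refl = mk≅ refl refl refl
≈⇒≅ (≈-sym e) with mk≅ s w d ← ≈⇒≅ e = mk≅ (sym s) (sym w) (sym d)
≈⇒≅ (≈-trans e f) with mk≅ s w d ← ≈⇒≅ e | mk≅ s′ w′ d′ ← ≈⇒≅ f =
  mk≅ (≡.trans s s′) (≡.trans w w′) (≡.trans d d′)
≈⇒≅ (⅋-cong {R} {R′} {T} {T′} e f) with mk≅ s w d ← ≈⇒≅ e | mk≅ s′ w′ d′ ← ≈⇒≅ f =
  mk≅ (cong₂ _+_ s s′) (⅋-weight {nnf R} {nnf R′} {nnf T} {nnf T′} s s′ w w′) (cong₂ _+_ d d′)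
≈⇒≅ (⊗-cong {R} {R′} {T} {T′} e f) with mk≅ s w d ← ≈⇒≅ e | mk≅ s′ w′ d′ ← ≈⇒≅ f =
  mk≅ (cong₂ _+_ s s′) (cong₂ _+_ w w′)
    (⅋-weight {dual (nnf R)} {dual (nnf R′)} {dual (nnf T)} {dual (nnf T′)}
      (dual-size {nnf R} {nnf R′} s) (dual-size {nnf T} {nnf T′} s′) d d′)
≈⇒≅ (‾-cong {R} {R′} e) with mk≅ s w d ← ≈⇒≅ e =
  mk≅ (dual-size {nnf R} {nnf R′} s) d
    (≡.trans (cong weight (dual-involutive (nnf R))) (≡.trans w (cong weight (sym (dual-involutive (nnf R′))))))
≈⇒≅ (⅋-assoc {R} {T} {U}) =
  mk≅ (+-assoc (size (nnf R)) _ _) (⅋-weight-assoc (nnf R) (nnf T) (nnf U))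
      (+-assoc (weight (dual (nnf R))) _ _)
≈⇒≅ (⊗-assoc {R} {T} {U}) =
  mk≅ (+-assoc (size (nnf R)) _ _) (+-assoc (weight (nnf R)) _ _)
      (⅋-weight-assoc (dual (nnf R)) (dual (nnf T)) (dual (nnf U)))
≈⇒≅ (⅋-comm {R} {T}) =
  mk≅ (+-comm (size (nnf R)) _) (⅋-weight-comm (nnf R) (nnf T)) (+-comm (weight (dual (nnf R))) _)
≈⇒≅ (⊗-comm {R} {T}) =
  mk≅ (+-comm (size (nnf R)) _) (+-comm (weight (nnf R)) _) (⅋-weight-comm (dual (nnf R)) (dual (nnf T)))
≈⇒≅ ‾-⅋ = mk≅ refl refl refl
≈⇒≅ ‾-⊗ = mk≅ refl refl refl
≈⇒≅ (‾-‾ {R}) rewrite dual-involutive (nnf R) = mk≅ refl refl refl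
≈⇒≅ ‾-⊥ = mk≅ refl refl refl
≈⇒≅ ‾-𝟙 = mk≅ refl refl refl

-- Growth of the weight along rules, and the cubic bound.

record _≺_ (A B : NNF) : Set where
  constructor mk≺
  field
    size≤   : size A ≤ size B
    weight< : weight A < weight B

⟨⟩-≺ : ∀ S {P Q} → nnf P ≺ nnf Q → nnf (S ⟨ P ⟩) ≺ nnf (S ⟨ Q ⟩)
⟨⟩-≺ ∙        p = p
⟨⟩-≺ (S ⅋ˡ T) p with mk≺ s w ← ⟨⟩-≺ S p =
  mk≺ (+-monoˡ-≤ _ s) (+-mono-<-≤ (+-monoˡ-< _ w) (*-monoˡ-≤ _ s))
⟨⟩-≺ (S ⊗ˡ T) p with mk≺ s w ← ⟨⟩-≺ S p = mk≺ (+-monoˡ-≤ _ s) (+-monoˡ-< _ w)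
⟨⟩-≺ (T ⅋ʳ S) p with mk≺ s w ← ⟨⟩-≺ S p =
  mk≺ (+-monoʳ-≤ _ s) (+-mono-<-≤ (+-monoʳ-< _ w) (*-monoʳ-≤ (size (nnf T)) s))
⟨⟩-≺ (T ⊗ʳ S) p with mk≺ s w ← ⟨⟩-≺ S p = mk≺ (+-monoʳ-≤ _ s) (+-monoʳ-< _ w)

ai-≺ : ∀ a → at′ 𝟙 ≺ nnf (⌜ a ⌝ ⅋ ‾ ⌜ a ⌝)
ai-≺ (pos _) = mk≺ (s≤s z≤n) (s≤s (s≤s z≤n))
ai-≺ (neg _) = mk≺ (s≤s z≤n) (s≤s (s≤s z≤n))
ai-≺ 𝟙       = mk≺ (s≤s z≤n) (s≤s (s≤s z≤n))
ai-≺ ⊥       = mk≺ (s≤s z≤n) (s≤s (s≤s z≤n))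

-- Pairs between `C` and `B` meet in a copar in the premise and in a par in the conclusion; the gain
-- `size C * size B` is positive.
dlis-≺ : ∀ A B C → ((C ⅋ A) ⊗ B) ≺ (C ⅋ (A ⊗ B))
dlis-≺ A B C = mk≺ (≤-reflexive (+-assoc (size C) _ _)) (begin-strict
  w C + w A + size C * size A + w B                        ≡⟨ shuffle (w C) (w A) (w B) (size C * size A) ⟩
  w C + (w A + w B) + size C * size A                      <⟨ +-monoʳ-< (w C + (w A + w B)) (m<m+n (size C * size A) (*-mono-≤ (0<size C) (0<size B))) ⟩
  w C + (w A + w B) + (size C * size A + size C * size B)  ≡⟨ cong (w C + (w A + w B) +_) (*-distribˡ-+ (size C) (size A) (size B)) ⟨
  w C + (w A + w B) + size C * (size A + size B)           ∎)
  where
  open ≤-Reasoning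
  w = weight
  shuffle : ∀ c a b x → c + a + x + b ≡ c + (a + b) + x
  shuffle = solve-∀

⟶⇒≺ : ∀ {P Q} → P ⟶ Q → nnf P ≺ nnf Q
⟶⇒≺ (ai↓ S a)            = ⟨⟩-≺ S (ai-≺ a)
⟶⇒≺ (u₁↓ S R)            = ⟨⟩-≺ S (mk≺ (m≤m+n _ _)
  (≤-trans (≤-reflexive (+-comm 1 _)) (m≤m+n _ _)))
⟶⇒≺ (u₂↓ S R)            = ⟨⟩-≺ S (mk≺ (m≤m+n _ _) (≤-reflexive (+-comm 1 _)))
⟶⇒≺ (dlis S R T U _ _ _) = ⟨⟩-≺ S (dlis-≺ (nnf R) (nnf T) (nnf U))

squares : ∀ {u v} a b → u ≤ a * a → v ≤ b * b → u + v + a * b ≤ (a + b) * (a + b)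
squares {u} {v} a b u≤ v≤ = begin
  u + v + a * b                  ≤⟨ +-monoˡ-≤ _ (+-mono-≤ u≤ v≤) ⟩
  a * a + b * b + a * b          ≤⟨ m≤m+n _ (a * b) ⟩
  a * a + b * b + a * b + a * b  ≡⟨ square a b ⟩
  (a + b) * (a + b)              ∎
  where
  open ≤-Reasoning
  square : ∀ x y → x * x + y * y + x * y + x * y ≡ (x + y) * (x + y)
  square = solve-∀

weight≤size² : ∀ A → weight A ≤ size A * size A
weight≤size² (at′ _) = s≤s z≤n
weight≤size² (A ⅋ B) = squares (size A) (size B) (weight≤size² A) (weight≤size² B)
weight≤size² (A ⊗ B) =
  ≤-trans (m≤m+n _ _) (squares (size A) (size B) (weight≤size² A) (weight≤size² B))

-- One more line costs at most one copy of the final size, and the weight has risen by at least one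
-- to pay for it.
proofSize≤ : ∀ {R} (Π : MLSdli R) → proofSize Π ≤ weight (nnf R) * size (nnf R)
proofSize≤ {R} (top e) rewrite length-leaves (nnf R) with mk≅ s w _ ← ≈⇒≅ e =
  ≤-reflexive (sym (≡.trans (cong (_* size (nnf R)) w) (*-identityˡ _)))
proofSize≤ {R} (step {P} {Q} Π r e) rewrite length-leaves (nnf R)
  with mk≺ s≤ w< ← ⟶⇒≺ r | mk≅ s≡ w≡ _ ← ≈⇒≅ e = begin
  proofSize Π + size (nnf R)                          ≤⟨ +-monoˡ-≤ _ (proofSize≤ Π) ⟩
  weight (nnf P) * size (nnf P) + size (nnf R)        ≤⟨ +-monoˡ-≤ _ (*-monoʳ-≤ (weight (nnf P)) (≤-trans s≤ (≤-reflexive s≡))) ⟩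
  weight (nnf P) * size (nnf R) + size (nnf R)        ≡⟨ +-comm _ (size (nnf R)) ⟩
  suc (weight (nnf P)) * size (nnf R)                 ≤⟨ *-monoˡ-≤ (size (nnf R)) (≤-trans w< (≤-reflexive w≡)) ⟩
  weight (nnf R) * size (nnf R)                       ∎
  where open ≤-Reasoning

cube : Polynomial
cube = 0 ∷ 0 ∷ 0 ∷ 1 ∷ []

proofSize-bound : ∀ {R n} (Π : MLSdli R) → ∣ R ∣ ≤ n → proofSize Π ≤ eval cube n
proofSize-bound {R} {n} Π r≤n = begin
  proofSize Π                          ≤⟨ proofSize≤ Π ⟩
  weight (nnf R) * s                   ≤⟨ *-monoˡ-≤ s (weight≤size² (nnf R)) ⟩
  s * s * s                            ≤⟨ *-mono-≤ (*-mono-≤ s≤n s≤n) s≤n ⟩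
  n * n * n                            ≡⟨ n³ n ⟩
  eval cube n                          ∎
  where
  open ≤-Reasoning
  s = size (nnf R)
  s≤n : s ≤ n
  s≤n = ≤-trans (≤-reflexive (sym (length-leaves (nnf R)))) r≤n
  -- The right-hand side is `eval cube n` unfolded, in a form the ring solver can read.
  n³ : ∀ n → n * n * n ≡ 0 + n * (0 + n * (0 + n * (1 + n * 0)))
  n³ = solve-∀

-- Derivations with an arbitrary premise.

infix 4 _⇒_ _⇒⁺_ ⊩_

data _⇒_ : Structure → Structure → Set where
  ≈⇒   : ∀ {P Q} → P ≈ Q → P ⇒ Q
  snoc : ∀ {P Q Q′ R} → P ⇒ Q → Q ⟶ Q′ → Q′ ≈ R → P ⇒ R

⇒-trans : ∀ {P Q R} → P ⇒ Q → Q ⇒ R → P ⇒ R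
⇒-trans (≈⇒ e)       (≈⇒ f)       = ≈⇒ (≈-trans e f)
⇒-trans (snoc d r e) (≈⇒ f)       = snoc d r (≈-trans e f)
⇒-trans d            (snoc c r e) = snoc (⇒-trans d c) r e

rule : ∀ {P Q} → P ⟶ Q → P ⇒ Q
rule r = snoc (≈⇒ ≈-refl) r ≈-refl

⟶-⅋ˡ : ∀ {P Q} T → P ⟶ Q → P ⅋ T ⟶ Q ⅋ T
⟶-⅋ˡ T (ai↓ S a)            = ai↓ (S ⅋ˡ T) a
⟶-⅋ˡ T (u₁↓ S R)            = u₁↓ (S ⅋ˡ T) R
⟶-⅋ˡ T (u₂↓ S R)            = u₂↓ (S ⅋ˡ T) R
⟶-⅋ˡ T (dlis S R V U m c p) = dlis (S ⅋ˡ T) R V U m c p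

⟶-⊗ˡ : ∀ {P Q} T → P ⟶ Q → P ⊗ T ⟶ Q ⊗ T
⟶-⊗ˡ T (ai↓ S a)            = ai↓ (S ⊗ˡ T) a
⟶-⊗ˡ T (u₁↓ S R)            = u₁↓ (S ⊗ˡ T) R
⟶-⊗ˡ T (u₂↓ S R)            = u₂↓ (S ⊗ˡ T) R
⟶-⊗ˡ T (dlis S R V U m c p) = dlis (S ⊗ˡ T) R V U m c p

⇒-⅋ˡ : ∀ {P Q} T → P ⇒ Q → P ⅋ T ⇒ Q ⅋ T
⇒-⅋ˡ T (≈⇒ e)       = ≈⇒ (⅋-cong e ≈-refl)
⇒-⅋ˡ T (snoc d r e) = snoc (⇒-⅋ˡ T d) (⟶-⅋ˡ T r) (⅋-cong e ≈-refl)

⇒-⊗ˡ : ∀ {P Q} T → P ⇒ Q → P ⊗ T ⇒ Q ⊗ T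
⇒-⊗ˡ T (≈⇒ e)       = ≈⇒ (⊗-cong e ≈-refl)
⇒-⊗ˡ T (snoc d r e) = snoc (⇒-⊗ˡ T d) (⟶-⊗ˡ T r) (⊗-cong e ≈-refl)

⅋-mono : ∀ {P P′ Q Q′} → P ⇒ P′ → Q ⇒ Q′ → P ⅋ Q ⇒ P′ ⅋ Q′
⅋-mono {P′ = P′} {Q} c d = ⇒-trans (⇒-⅋ˡ Q c)
  (⇒-trans (≈⇒ ⅋-comm) (⇒-trans (⇒-⅋ˡ P′ d) (≈⇒ ⅋-comm)))

⊗-mono : ∀ {P P′ Q Q′} → P ⇒ P′ → Q ⇒ Q′ → P ⊗ Q ⇒ P′ ⊗ Q′
⊗-mono {P′ = P′} {Q} c d = ⇒-trans (⇒-⊗ˡ Q c)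
  (⇒-trans (≈⇒ ⊗-comm) (⇒-trans (⇒-⊗ˡ P′ d) (≈⇒ ⊗-comm)))

extend : ∀ {P Q} → MLSdli P → P ⇒ Q → MLSdli Q
extend (top e)      (≈⇒ f)       = top (≈-trans (≈-sym f) e)
extend (step Π r e) (≈⇒ f)       = step Π r (≈-trans e f)
extend Π            (snoc d r e) = step (extend Π d) r e

-- At least one rule instance is required, so that the weight grows strictly and proof search
-- terminates.
data _⇒⁺_ (P R : Structure) : Set where
  snoc : ∀ {Q Q′} → P ⇒ Q → Q ⟶ Q′ → Q′ ≈ R → P ⇒⁺ R

⇒⁺⇒⇒ : ∀ {P R} → P ⇒⁺ R → P ⇒ R
⇒⁺⇒⇒ (snoc d r e) = snoc d r e

⇒-⇒⁺ : ∀ {P Q R} → P ⇒ Q → Q ⇒⁺ R → P ⇒⁺ R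
⇒-⇒⁺ c (snoc d r e) = snoc (⇒-trans c d) r e

⇒⁺-≈ : ∀ {P Q R} → P ⇒⁺ Q → Q ≈ R → P ⇒⁺ R
⇒⁺-≈ (snoc d r e) f = snoc d r (≈-trans e f)

⇒⁺-⅋ˡ : ∀ {P Q} T → P ⇒⁺ Q → P ⅋ T ⇒⁺ Q ⅋ T
⇒⁺-⅋ˡ T (snoc d r e) = snoc (⇒-⅋ˡ T d) (⟶-⅋ˡ T r) (⅋-cong e ≈-refl)

⇒⁺-⊗ˡ : ∀ {P Q} T → P ⇒⁺ Q → P ⊗ T ⇒⁺ Q ⊗ T
⇒⁺-⊗ˡ T (snoc d r e) = snoc (⇒-⊗ˡ T d) (⟶-⊗ˡ T r) (⊗-cong e ≈-refl)

⇒-weight : ∀ {P Q} → P ⇒ Q → weight (nnf P) ≤ weight (nnf Q)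
⇒-weight (≈⇒ e)       = ≤-reflexive (_≅_.weight≡ (≈⇒≅ e))
⇒-weight (snoc d r e) = ≤-trans (⇒-weight d)
  (≤-trans (<⇒≤ (_≺_.weight< (⟶⇒≺ r))) (≤-reflexive (_≅_.weight≡ (≈⇒≅ e))))

⇒⁺-weight : ∀ {P Q} → P ⇒⁺ Q → weight (nnf P) < weight (nnf Q)
⇒⁺-weight (snoc d r e) = ≤-<-trans (⇒-weight d)
  (<-≤-trans (_≺_.weight< (⟶⇒≺ r)) (≤-reflexive (_≅_.weight≡ (≈⇒≅ e))))

-- Blocks and their reading as structures.

-- Structures with nested pars flattened and with ⊥ represented by the empty block.
data Item : Set where
  𝟙         : Item
  var covar : ℕ → Item
  _⊗_       : List Item → List Item → Item

Block : Set
Block = List Item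

mutual
  ⟦_⟧ : Item → Structure
  ⟦ 𝟙 ⟧       = 𝟙
  ⟦ var n ⟧   = atom n
  ⟦ covar n ⟧ = ‾ (atom n)
  ⟦ A ⊗ B ⟧   = ⟪ A ⟫ ⊗ ⟪ B ⟫

  ⟪_⟫ : Block → Structure
  ⟪ [] ⟫         = ⊥
  ⟪ x ∷ [] ⟫     = ⟦ x ⟧
  ⟪ x ∷ y ∷ ys ⟫ = ⟦ x ⟧ ⅋ ⟪ y ∷ ys ⟫

-- This is a derivation rather than an equivalence: `≈` has no unit laws, so for empty `xs` the `⊥`
-- comes from `u₁↓`.
⟪∷⟫ : ∀ x xs → ⟪ x ∷ xs ⟫ ⇒ ⟦ x ⟧ ⅋ ⟪ xs ⟫
⟪∷⟫ x []       = rule (u₁↓ ∙ _)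
⟪∷⟫ x (y ∷ ys) = ≈⇒ ≈-refl

⟪++⟫ : ∀ xs ys → ⟪ xs ++ ys ⟫ ⇒ ⟪ xs ⟫ ⅋ ⟪ ys ⟫
⟪++⟫ []           ys = ⇒-trans (rule (u₁↓ ∙ _)) (≈⇒ ⅋-comm)
⟪++⟫ (x ∷ [])     ys = ⟪∷⟫ x ys
⟪++⟫ (x ∷ z ∷ zs) ys =
  ⇒-trans (⅋-mono (≈⇒ ≈-refl) (⟪++⟫ (z ∷ zs) ys)) (≈⇒ (≈-sym ⅋-assoc))

-- No `⊥` arises when both blocks are nonempty, so here the par can be merged in the conclusion of a
-- derivation too.
⟪++⟫-nonempty : ∀ x xs y ys → ⟪ x ∷ xs ⟫ ⅋ ⟪ y ∷ ys ⟫ ≈ ⟪ x ∷ xs ++ y ∷ ys ⟫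
⟪++⟫-nonempty x []       y ys = ≈-refl
⟪++⟫-nonempty x (z ∷ zs) y ys = ≈-trans ⅋-assoc (⅋-cong ≈-refl (⟪++⟫-nonempty z zs y ys))

⟪⟫-↭ : ∀ {xs ys} → xs ↭ ys → ⟪ xs ⟫ ≈ ⟪ ys ⟫
⟪⟫-↭ refl = ≈-refl
⟪⟫-↭ (prep {[]} {ys} x p) with refl ← ↭-empty-inv (↭-sym p) = ≈-refl
⟪⟫-↭ (prep {_ ∷ _} {[]} x p) with () ← ↭-empty-inv p
⟪⟫-↭ (prep {_ ∷ _} {_ ∷ _} x p) = ⅋-cong ≈-refl (⟪⟫-↭ p)
⟪⟫-↭ (swap {[]} {ys} x y p) with refl ← ↭-empty-inv (↭-sym p) = ⅋-comm
⟪⟫-↭ (swap {_ ∷ _} {[]} x y p) with () ← ↭-empty-inv p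
⟪⟫-↭ (swap {_ ∷ _} {_ ∷ _} x y p) = ≈-trans (≈-sym ⅋-assoc)
  (≈-trans (⅋-cong ⅋-comm ≈-refl) (≈-trans ⅋-assoc (⅋-cong ≈-refl (⅋-cong ≈-refl (⟪⟫-↭ p)))))
⟪⟫-↭ (trans p q) = ≈-trans (⟪⟫-↭ p) (⟪⟫-↭ q)

⇒⁺-++ : ∀ A x xs ys → ⟪ A ⟫ ⇒⁺ ⟪ x ∷ xs ⟫ → ⟪ A ++ ys ⟫ ⇒⁺ ⟪ x ∷ xs ++ ys ⟫
⇒⁺-++ A x xs [] d rewrite ++-identityʳ A | ++-identityʳ xs = d
⇒⁺-++ A x xs (y ∷ ys) d = ⇒-⇒⁺ (⟪++⟫ A (y ∷ ys))
  (⇒⁺-≈ (⇒⁺-⅋ˡ _ d) (⟪++⟫-nonempty x xs y ys))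

-- A cut-free sequent calculus on blocks.

open CommutativeMonoidSolver (++-commutativeMonoid {A = Item}) using (solve; _⊕_; _⊜_)

-- Rules for par and `⊥` are absent because flattening absorbs them: a factor of a tensor is a
-- block, and all its items enter the premise.
data ⊩_ : List Item → Set where
  ax   : ∀ n → ⊩ var n ∷ covar n ∷ []
  one  : ⊩ [ 𝟙 ]
  tens : ∀ {A B Γ Δ} → ⊩ A ++ Γ → ⊩ B ++ Δ → ⊩ (A ⊗ B) ∷ Γ ++ Δ
  exch : ∀ {Γ Δ} → Γ ↭ Δ → ⊩ Γ → ⊩ Δ

flatten : NNF → Block
flatten (at′ (pos n)) = [ var n ]
flatten (at′ (neg n)) = [ covar n ]
flatten (at′ 𝟙)       = [ 𝟙 ]
flatten (at′ ⊥)       = []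
flatten (A ⅋ B)       = flatten A ++ flatten B
flatten (A ⊗ B)       = [ flatten A ⊗ flatten B ]

embed : NNF → Structure
embed (at′ a) = ⌜ a ⌝
embed (A ⅋ B) = embed A ⅋ embed B
embed (A ⊗ B) = embed A ⊗ embed B

-- The occurrences of `⊥` that flattening erased are restored by `u₁↓`, through `⟪++⟫`.
flatten⇒embed : ∀ A → ⟪ flatten A ⟫ ⇒ embed A
flatten⇒embed (at′ (pos n)) = ≈⇒ ≈-refl
flatten⇒embed (at′ (neg n)) = ≈⇒ ≈-refl
flatten⇒embed (at′ 𝟙)       = ≈⇒ ≈-refl
flatten⇒embed (at′ ⊥)       = ≈⇒ ≈-refl
flatten⇒embed (A ⅋ B) =
  ⇒-trans (⟪++⟫ (flatten A) (flatten B)) (⅋-mono (flatten⇒embed A) (flatten⇒embed B))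
flatten⇒embed (A ⊗ B) = ⊗-mono (flatten⇒embed A) (flatten⇒embed B)

embed-dual : ∀ A → embed (dual A) ≈ ‾ (embed A)
embed-dual (at′ (pos n)) = ≈-refl
embed-dual (at′ (neg n)) = ≈-sym ‾-‾
embed-dual (at′ 𝟙)       = ≈-sym ‾-𝟙
embed-dual (at′ ⊥)       = ≈-sym ‾-⊥
embed-dual (A ⅋ B) = ≈-trans (⊗-cong (embed-dual A) (embed-dual B)) (≈-sym ‾-⅋)
embed-dual (A ⊗ B) = ≈-trans (⅋-cong (embed-dual A) (embed-dual B)) (≈-sym ‾-⊗)

embed-nnf : ∀ R → embed (nnf R) ≈ R
embed-nnf (atom n) = ≈-refl
embed-nnf 𝟙        = ≈-refl
embed-nnf ⊥        = ≈-refl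
embed-nnf (R ⅋ T)  = ⅋-cong (embed-nnf R) (embed-nnf T)
embed-nnf (R ⊗ T)  = ⊗-cong (embed-nnf R) (embed-nnf T)
embed-nnf (‾ R)    = ≈-trans (embed-dual (nnf R)) (‾-cong (embed-nnf R))

-- General axioms expand to atomic ones; the tensor rule is applied to whichever of `A` and its dual
-- is a copar.
identity : ∀ A → ⊩ flatten A ++ flatten (dual A)
identity (at′ (pos n)) = ax n
identity (at′ (neg n)) = exch (swap _ _ refl) (ax n)
identity (at′ 𝟙)       = one
identity (at′ ⊥)       = one
identity (A ⅋ B)       = exch
  (↭-sym (++-comm (flatten A ++ flatten B) _))
  (tens (exch (++-comm (flatten A) _) (identity A)) (exch (++-comm (flatten B) _) (identity B)))
identity (A ⊗ B)       = tens (identity A) (identity B)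

concatMap-↭ : ∀ {A B : Set} (f : A → List B) {xs ys} → xs ↭ ys → concatMap f xs ↭ concatMap f ys
concatMap-↭ f refl         = refl
concatMap-↭ f (prep x p)   = ++⁺ˡ (f x) (concatMap-↭ f p)
concatMap-↭ f (swap x y p) = trans (shifts (f x) (f y)) (++⁺ˡ (f y) (++⁺ˡ (f x) (concatMap-↭ f p)))
concatMap-↭ f (trans p q)  = trans (concatMap-↭ f p) (concatMap-↭ f q)

⊢⇒⊩ : ∀ {Φ} → ⊢ Φ → ⊩ concatMap flatten Φ
⊢⇒⊩ (ax A) rewrite ++-identityʳ (flatten (dual A)) = identity A
⊢⇒⊩ one = one
⊢⇒⊩ (bot d) = ⊢⇒⊩ d
⊢⇒⊩ (par {A} {B} {Φ} d) rewrite ++-assoc (flatten A) (flatten B) (concatMap flatten Φ) = ⊢⇒⊩ d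
⊢⇒⊩ (tens {Φ = Φ} {Ψ} d e) rewrite concatMap-++ flatten Φ Ψ = tens (⊢⇒⊩ d) (⊢⇒⊩ e)
⊢⇒⊩ (exch p d) = exch (concatMap-↭ flatten p) (⊢⇒⊩ d)

-- The side conditions of `dlis`.

leaves-dual : ∀ A → leaves (dual A) ≡ map dualAtom (leaves A)
leaves-dual (at′ a) = refl
leaves-dual (A ⅋ B) rewrite leaves-dual A | leaves-dual B = sym (map-++ dualAtom (leaves A) (leaves B))
leaves-dual (A ⊗ B) rewrite leaves-dual A | leaves-dual B = sym (map-++ dualAtom (leaves A) (leaves B))

-- The dual of the shared atom is the new witness.
meet-sym : ∀ R T → at (‾ R) ≬ at T → at (‾ T) ≬ at R
meet-sym R T (a , a∈R̄ , a∈T)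
  with b , b∈R , refl ← ∈-map⁻ dualAtom (subst (a ∈_) (leaves-dual (nnf R)) a∈R̄) =
  b , subst (b ∈_) (sym (leaves-dual (nnf T)))
        (subst (_∈ map dualAtom (leaves (nnf T))) (dualAtom-involutive b) (∈-map⁺ dualAtom a∈T)) ,
  b∈R

meet-⊆ʳ : ∀ {R T T′} → at T ⊆ at T′ → at (‾ R) ≬ at T → at (‾ R) ≬ at T′
meet-⊆ʳ T⊆T′ (a , a∈R̄ , a∈T) = a , a∈R̄ , T⊆T′ a∈T

meet-⊆ˡ : ∀ {R R′ T} → at R ⊆ at R′ → at (‾ R) ≬ at T → at (‾ R′) ≬ at T
meet-⊆ˡ {R} {R′} {T} R⊆R′ m = meet-sym T R′ (meet-⊆ʳ {T} {R} {R′} R⊆R′ (meet-sym R T m))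

∈⇒at⊆ : ∀ {x xs} → x ∈ xs → at ⟦ x ⟧ ⊆ at ⟪ xs ⟫
∈⇒at⊆ {xs = _ ∷ []}     (here refl) a∈ = a∈
∈⇒at⊆ {xs = _ ∷ _ ∷ _}  (here refl) a∈ = ∈-++⁺ˡ a∈
∈⇒at⊆ {xs = y ∷ _ ∷ _}  (there x∈)  a∈ = ∈-++⁺ʳ (leaves (nnf ⟦ y ⟧)) (∈⇒at⊆ x∈ a∈)

↭∷⇒at⊆ : ∀ {x xs ys} → xs ↭ x ∷ ys → at ⟦ x ⟧ ⊆ at ⟪ xs ⟫
↭∷⇒at⊆ p = ∈⇒at⊆ (∈-resp-↭ (↭-sym p) (here refl))

-- Flattening leaves no par and no `⊥` among items, so any item may be the `U` of a switch.
item-CoparOrAtom≢⊥ : ∀ x → CoparOrAtom≢⊥ (nnf ⟦ x ⟧)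
item-CoparOrAtom≢⊥ 𝟙         = atom λ ()
item-CoparOrAtom≢⊥ (var _)   = atom λ ()
item-CoparOrAtom≢⊥ (covar _) = atom λ ()
item-CoparOrAtom≢⊥ (_ ⊗ _)   = copar

data UnitOrCopar : Item → Set where
  𝟙   : UnitOrCopar 𝟙
  _⊗_ : ∀ A B → UnitOrCopar (A ⊗ B)

-- A block fails the condition on `R` only as a single `𝟙` or a single copar; the empty block, read
-- as `⊥`, satisfies it.
block-shape : ∀ A → ParOrAtom≢𝟙 (nnf ⟪ A ⟫) ⊎ (∃[ x ] A ≡ [ x ] × UnitOrCopar x)
block-shape []            = inj₁ (atom λ ())
block-shape (𝟙 ∷ [])      = inj₂ (_ , refl , 𝟙)
block-shape (var _ ∷ [])  = inj₁ (atom λ ())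
block-shape (covar _ ∷ []) = inj₁ (atom λ ())
block-shape (A ⊗ B ∷ [])  = inj₂ (_ , refl , A ⊗ B)
block-shape (_ ∷ _ ∷ _)   = inj₁ par

-- Interactions read off a sequent proof.

-- y can be switched into the factor R of x. The result Z and its provability are
-- parametric in y, so that they survive when a later tensor rule enlarges y.
record Move (x y : Item) (Ψ : List Item) : Set where
  field
    {R T} : Structure
    factor    : ⟦ x ⟧ ≈ R ⊗ T
    receptive : ParOrAtom≢𝟙 (nnf R)
    meet      : at (‾ R) ≬ at ⟦ y ⟧
    Z         : Item → Item
    fill      : ∀ y′ → ⟦ Z y′ ⟧ ⇒ (⟦ y′ ⟧ ⅋ R) ⊗ T
    proof     : ∀ {y′ Δ} → (∀ Θ → ⊩ y ∷ Θ → ⊩ y′ ∷ Θ ++ Δ) → ⊩ Z y′ ∷ Ψ ++ Δ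

data Link : Item → Item → List Item → Set where
  ai   : ∀ {n Ψ} → ⊩ 𝟙 ∷ Ψ → Link (var n) (covar n) Ψ
  move : ∀ {x y Ψ} → Move x y Ψ → Link x y Ψ

-- `pair` records an interaction without performing it, since a later tensor rule may take `x` or
-- `y` into a factor and the interaction must then be adapted.
data Step (Φ : List Item) : Set where
  done   : Φ ≡ [ 𝟙 ] → Step Φ
  inside : ∀ {x} A Ψ → Φ ↭ x ∷ Ψ → ⟪ A ⟫ ⇒⁺ ⟦ x ⟧ → ⊩ A ++ Ψ → Step Φ
  pair   : ∀ {x y Ψ} → Φ ↭ x ∷ y ∷ Ψ → at (‾ ⟦ x ⟧) ≬ at ⟦ y ⟧ → Link x y Ψ → Step Φ

contract : ∀ {x y Ψ} → Link x y Ψ → ∃[ z ] ⟦ z ⟧ ⇒⁺ ⟦ x ⟧ ⅋ ⟦ y ⟧ × ⊩ z ∷ Ψ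
contract (ai {n} d) = 𝟙 , snoc (≈⇒ ≈-refl) (ai↓ ∙ (pos n)) ≈-refl , d
contract {x} {y} {Ψ} (move m) = Z y ,
  snoc (fill y) (dlis ∙ R T ⟦ y ⟧ meet (item-CoparOrAtom≢⊥ y) receptive)
    -- The moving item is `y` itself, and the extra context `Δ` of the move is empty.
    (≈-trans ⅋-comm (⅋-cong (≈-sym factor) ≈-refl)) ,
  subst (λ Θ → ⊩ Z y ∷ Θ) (++-identityʳ Ψ)
    (proof (λ Θ d → subst (λ Ξ → ⊩ y ∷ Ξ) (sym (++-identityʳ Θ)) d))
  where open Move m

-- The argument is uniform in `z` and `Θ` because a move leaves open both its result and the context
-- still to be added.
mapLink : ∀ {x y Ψ Ψ′} → (∀ z Θ → ⊩ z ∷ Ψ ++ Θ → ⊩ z ∷ Ψ′ ++ Θ) → Link x y Ψ → Link x y Ψ′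
mapLink {Ψ = Ψ} {Ψ′} f (ai d) = ai (subst (λ Θ → ⊩ 𝟙 ∷ Θ) (++-identityʳ Ψ′)
  (f 𝟙 [] (subst (λ Θ → ⊩ 𝟙 ∷ Θ) (sym (++-identityʳ Ψ)) d)))
mapLink f (move m) = move record
  { factor = factor ; receptive = receptive ; meet = meet ; Z = Z ; fill = fill
  ; proof = λ k → f _ _ (proof k) }
  where open Move m

-- Steps through the tensor rule.

extract : ∀ {x Ψ} xs {ys : List Item} → xs ++ ys ↭ x ∷ Ψ →
  (∃[ xs′ ] xs ↭ x ∷ xs′ × Ψ ↭ xs′ ++ ys) ⊎ (∃[ ys′ ] ys ↭ x ∷ ys′ × Ψ ↭ xs ++ ys′)
extract {x} xs {ys} p with ∈-++⁻ xs (∈-resp-↭ (↭-sym p) (here refl))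
... | inj₁ x∈xs with l , r , refl ← ∈-∃++ x∈xs =
  inj₁ (l ++ r , shift x l r , drop-∷ (trans (↭-sym p) (++⁺ʳ ys (shift x l r))))
... | inj₂ x∈ys with l , r , refl ← ∈-∃++ x∈ys =
  inj₂ (l ++ r , shift x l r ,
    drop-∷ (trans (↭-sym p) (trans (++⁺ˡ xs (shift x l r)) (shift x xs (l ++ r)))))

-- Moving `y` beside `A` keeps the left premise of the tensor rule: `y` merely counts as part of the
-- factor instead of the context.
receive : ∀ {A B y Γ Δ} → ParOrAtom≢𝟙 (nnf ⟪ A ⟫) → at (‾ ⟪ A ⟫) ≬ at ⟦ y ⟧ →
  ⊩ y ∷ A ++ Γ → ⊩ B ++ Δ → Move (A ⊗ B) y (Γ ++ Δ)
receive {A} {B} {y} {Γ} {Δ} r m d e = record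
  { factor    = ≈-refl
  ; receptive = r
  ; meet      = m
  ; Z         = λ y′ → (y′ ∷ A) ⊗ B
  ; fill      = λ y′ → ⇒-⊗ˡ ⟪ B ⟫ (⟪∷⟫ y′ A)
  ; proof     = λ {y′} {Δ′} k → exch
      (prep _ (solve 3 (λ g d′ d → (g ⊕ d′) ⊕ d ⊜ (g ⊕ d) ⊕ d′) refl Γ Δ′ Δ))
      (tens {A = y′ ∷ A} {Γ = Γ ++ Δ′}
        (exch (prep _ (solve 3 (λ a g d → (a ⊕ g) ⊕ d ⊜ a ⊕ (g ⊕ d)) refl A Γ Δ′)) (k (A ++ Γ) d)) e)
  }

-- With `x` equivalent to `R ⊗ T`, the larger host is `R ⊗ (T ⊗ B)`, so the factor `R` stays
-- available.
move-tensˡ : ∀ {x y Γ B Δ} → Move x y Γ → ⊩ B ++ Δ → Move ([ x ] ⊗ B) y (Γ ++ Δ)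
move-tensˡ {x} {y} {Γ} {B} {Δ} m e = record
  { factor    = ≈-trans (⊗-cong factor ≈-refl) ⊗-assoc
  ; receptive = receptive
  ; meet      = meet
  ; Z         = λ y′ → [ Z y′ ] ⊗ B
  ; fill      = λ y′ → ⇒-trans (⇒-⊗ˡ ⟪ B ⟫ (fill y′)) (≈⇒ ⊗-assoc)
  ; proof     = λ {y′} {Δ′} k → exch
      (prep _ (solve 3 (λ g d′ d → (g ⊕ d′) ⊕ d ⊜ (g ⊕ d) ⊕ d′) refl Γ Δ′ Δ))
      (tens {A = [ Z y′ ]} (proof k) e)
  }
  where open Move m

-- The moving item grows to `y ⊗ B`. Whatever replaces it also replaces `y`, once a tensor with the
-- proof of `B` is inserted; `Δ` joins the extra context.
move-tensʳ : ∀ {x y Γ B Δ} → Move x y Γ → ⊩ B ++ Δ → Move x ([ y ] ⊗ B) (Γ ++ Δ)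
move-tensʳ {x} {y} {Γ} {B} {Δ} m e = record
  { factor    = factor
  ; receptive = receptive
  ; meet      = meet-⊆ʳ {R} {⟦ y ⟧} {⟦ [ y ] ⊗ B ⟧} ∈-++⁺ˡ meet
  ; Z         = Z
  ; fill      = fill
  ; proof     = λ {y′} {Δ′} k → exch
      (prep _ (solve 3 (λ g d d′ → g ⊕ d ⊕ d′ ⊜ (g ⊕ d) ⊕ d′) refl Γ Δ Δ′))
      (proof λ Θ d → exch
        (prep _ (solve 3 (λ t d d′ → (t ⊕ d) ⊕ d′ ⊜ t ⊕ d ⊕ d′) refl Θ Δ Δ′))
        (k (Θ ++ Δ) (tens {A = [ y ]} d e)))
  }
  where open Move m

⟪++⟫⇒⁺ : ∀ {A xs ys} X x → A ↭ x ∷ xs ++ ys → ⟪ X ⟫ ⇒⁺ ⟪ x ∷ xs ⟫ → ⟪ X ++ ys ⟫ ⇒⁺ ⟪ A ⟫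
⟪++⟫⇒⁺ {xs = xs} {ys} X x p r = ⇒⁺-≈ (⇒⁺-++ X x xs ys r) (⟪⟫-↭ (↭-sym p))

step-tens : ∀ {A B Γ Δ} → Step (A ++ Γ) → ⊩ A ++ Γ → ⊩ B ++ Δ → Step ((A ⊗ B) ∷ Γ ++ Δ)
-- Here `A` is `⊥`; the atom shared with the context is `𝟙`, the dual of that `⊥`.
step-tens {[]} {B} {.([ 𝟙 ])} {Δ} (done refl) d e = pair {x = [] ⊗ B} {𝟙} {Δ} refl
  (𝟙 , here refl , here refl)
  (move (receive {[]} {B} {𝟙} {[]} {Δ} (atom λ ()) (𝟙 , here refl , here refl) one e))
step-tens {𝟙 ∷ []} {B} {[]} {Δ} (done refl) d e =
  inside B Δ refl (snoc (≈⇒ ≈-refl) (u₂↓ ∙ _) ⊗-comm) e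
step-tens {A} {B} {Γ} {Δ} (inside {x} X Ψ p r d′) d e with extract A p
... | inj₁ (A′ , A↭ , Ψ↭) =
  inside [ (X ++ A′) ⊗ B ] (Γ ++ Δ) refl (⇒⁺-⊗ˡ ⟪ B ⟫ (⟪++⟫⇒⁺ X x A↭ r))
    (tens {A = X ++ A′} {Γ = Γ}
      (exch (trans (++⁺ˡ X Ψ↭) (solve 3 (λ x a g → x ⊕ (a ⊕ g) ⊜ (x ⊕ a) ⊕ g) refl X A′ Γ)) d′) e)
... | inj₂ (Γ′ , Γ↭ , Ψ↭) =
  inside X ((A ⊗ B) ∷ Γ′ ++ Δ) (trans (prep _ (++⁺ʳ Δ Γ↭)) (swap _ _ refl)) r
    (exch (solve 4 (λ t x g d → t ⊕ (x ⊕ g) ⊕ d ⊜ x ⊕ (t ⊕ g ⊕ d)) refl [ A ⊗ B ] X Γ′ Δ)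
      (tens {A = A} {Γ = X ++ Γ′}
        (exch (trans (++⁺ˡ X Ψ↭) (solve 3 (λ x a g → x ⊕ a ⊕ g ⊜ a ⊕ x ⊕ g) refl X A Γ′)) d′) e))
step-tens {A} {B} {Γ} {Δ} (pair {x} {y} {Ψ} p m l) d e with extract A p
... | inj₁ (A₁ , A↭ , yΨ↭) with extract A₁ (↭-sym yΨ↭)
-- Both partners lie in `A`, so the interaction is performed inside the factor.
...   | inj₁ (A₂ , A₁↭ , Ψ↭) with z , r , d′ ← contract l =
  inside [ (z ∷ A₂) ⊗ B ] (Γ ++ Δ) refl
    (⇒⁺-⊗ˡ ⟪ B ⟫ (⟪++⟫⇒⁺ {xs = [ y ]} [ z ] x (trans A↭ (prep x A₁↭)) r))
    (tens {A = z ∷ A₂} {Γ = Γ} (exch (prep z Ψ↭) d′) e)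
...   | inj₂ (Γ′ , Γ↭ , Ψ↭) with block-shape A
...     | inj₁ s = pair {x = A ⊗ B} {y} {Γ′ ++ Δ} (prep _ (++⁺ʳ Δ Γ↭))
  (meet-⊆ˡ {⟪ A ⟫} {⟦ A ⊗ B ⟧} {⟦ y ⟧} ∈-++⁺ˡ m′)
  (move (receive {A} {B} {y} {Γ′} s m′ (exch (trans (++⁺ˡ A Γ↭) (shift y A Γ′)) d) e))
  where m′ = meet-⊆ˡ {⟦ x ⟧} {⟪ A ⟫} {⟦ y ⟧} (↭∷⇒at⊆ A↭) m
-- Now `A` is `x` alone, a `𝟙` or a copar: an axiom link is impossible, and the old move into `x` is
-- lifted.
...     | inj₂ (x′ , refl , c) with refl ← ↭-singleton-inv (↭-sym A↭) with l
...       | ai _ with () ← c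
...       | move mv = pair {Ψ = Γ′ ++ Δ} (prep _ (++⁺ʳ Δ Γ↭))
  (meet-⊆ˡ {⟦ x ⟧} {⟦ [ x ] ⊗ B ⟧} {⟦ y ⟧} ∈-++⁺ˡ m)
  (mapLink (λ z Θ → exch (prep z (++⁺ʳ Θ (++⁺ʳ Δ Ψ↭)))) (move (move-tensˡ mv e)))
step-tens {A} {B} {Γ} {Δ} (pair {x} {y} {Ψ} p m l) d e
    | inj₂ (Γ₁ , Γ↭ , yΨ↭) with extract A (↭-sym yΨ↭)
-- Both partners lie in the context: the link survives, with the tensor rule applied again below its
-- proof.
...   | inj₂ (Γ₂ , Γ₁↭ , Ψ↭) = pair
  (trans (prep _ (++⁺ʳ Δ (trans Γ↭ (prep x Γ₁↭))))
    (↭-sym (shift (A ⊗ B) (x ∷ y ∷ []) (Γ₂ ++ Δ))))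
  m
  (mapLink (λ z Θ d′ → exch
      (solve 5 (λ t z g θ d → t ⊕ (z ⊕ g ⊕ θ) ⊕ d ⊜ z ⊕ (t ⊕ g ⊕ d) ⊕ θ) refl [ A ⊗ B ] [ z ] Γ₂ Θ Δ)
      (tens {A = A} {Γ = z ∷ Γ₂ ++ Θ}
        (exch (trans (prep z (++⁺ʳ Θ Ψ↭))
          (solve 4 (λ z a g θ → z ⊕ (a ⊕ g) ⊕ θ ⊜ a ⊕ z ⊕ g ⊕ θ) refl [ z ] A Γ₂ Θ)) d′) e))
    l)
...   | inj₁ (A′ , A↭ , Ψ↭) with block-shape A
-- The roles are exchanged: `x` is switched into `A`, which contains `y`, whatever the old link was.
...     | inj₁ s = pair {x = A ⊗ B} {x} {Γ₁ ++ Δ} (prep _ (++⁺ʳ Δ Γ↭))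
  (meet-⊆ˡ {⟪ A ⟫} {⟦ A ⊗ B ⟧} {⟦ x ⟧} ∈-++⁺ˡ m′)
  (move (receive {A} {B} {x} {Γ₁} s m′ (exch (trans (++⁺ˡ A Γ↭) (shift x A Γ₁)) d) e))
  where m′ = meet-⊆ˡ {⟦ y ⟧} {⟪ A ⟫} {⟦ x ⟧} (↭∷⇒at⊆ A↭) (meet-sym ⟦ x ⟧ ⟦ y ⟧ m)
-- `A` is `y` alone and cannot receive, so all of `A ⊗ B` moves into `x` in place of `y`.
...     | inj₂ (y′ , refl , c) with refl ← ↭-singleton-inv (↭-sym A↭) with l
...       | ai _ with () ← c
...       | move mv = pair {Ψ = Γ₁ ++ Δ} (trans (prep _ (++⁺ʳ Δ Γ↭)) (swap _ _ refl))
  (meet-⊆ʳ {⟦ x ⟧} {⟦ y ⟧} {⟦ [ y ] ⊗ B ⟧} ∈-++⁺ˡ m)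
  (mapLink (λ z Θ → exch (prep z (++⁺ʳ Θ (++⁺ʳ Δ Ψ↭)))) (move (move-tensʳ mv e)))

-- Completeness and the simulation.

step-exch : ∀ {Φ Ψ} → Φ ↭ Ψ → Step Φ → Step Ψ
step-exch p (done refl)        = done (↭-singleton-inv (↭-sym p))
step-exch p (inside A Ψ q r d) = inside A Ψ (trans (↭-sym p) q) r d
step-exch p (pair q m l)       = pair (trans (↭-sym p) q) m l

progress : ∀ {Φ} → ⊩ Φ → Step Φ
progress (ax n)               = pair refl (neg n , here refl , here refl) (ai one)
progress one                  = done refl
progress (tens {A} {Γ = Γ} d e) = step-tens {A} {Γ = Γ} (progress d) d e
progress (exch p d)           = step-exch p (progress d)

-- Recursion is on the weight of the block, since the sequent proof of the new premise is rebuilt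
-- and need not be a subproof.
⊩⇒proof : ∀ {Φ} → Acc _<_ (weight (nnf ⟪ Φ ⟫)) → ⊩ Φ → 𝟙 ⇒ ⟪ Φ ⟫
⊩⇒proof (acc rec) d with progress d
... | done refl = ≈⇒ ≈-refl
... | inside {x} A Ψ p r d′ = ⇒-trans (⊩⇒proof (rec (⇒⁺-weight r′)) d′) (⇒⁺⇒⇒ r′)
  where r′ = ⟪++⟫⇒⁺ A x p r
... | pair {x} {y} {Ψ} p m l with z , r , d′ ← contract l =
  ⇒-trans (⊩⇒proof (rec (⇒⁺-weight r′)) d′) (⇒⁺⇒⇒ r′)
  where r′ = ⟪++⟫⇒⁺ {xs = [ y ]} [ z ] x p r

completeness : ∀ R → Theorem R → MLSdli R
completeness R d = extend (top ≈-refl) (⇒-trans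
  (subst (λ Φ → 𝟙 ⇒ ⟪ Φ ⟫) (++-identityʳ (flatten (nnf R))) (⊩⇒proof (<-wellFounded _) (⊢⇒⊩ d)))
  (⇒-trans (flatten⇒embed (nnf R)) (≈⇒ (embed-nnf R))))

corollary2p39 : ∀ {ℓ : Level} (𝒮′ : ProofSystem ℓ) →
    ∃ λ (p : Polynomial) →
    ∀ (Π : ProofSystem.Proof 𝒮′) →
    ∃ λ (Π′ : MLSdli (ProofSystem.conclusion 𝒮′ Π)) →
    proofSize Π′ ≤ eval p (ProofSystem.size 𝒮′ Π)
corollary2p39 𝒮′ = cube , λ Π →
  let Π′ = completeness (conclusion Π) (Equivalence.to (provable⇔theorem _) (Π , ≈-refl))
  in Π′ , proofSize-bound Π′ (conclusion≤size Π)
  where open ProofSystem 𝒮′
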